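{- Let $n\ge 1$ and let $G$ be a graph on the vertex set $[n]=\{1,\dots,n\}$. Assume there exists an involution $\tau$ of $[n]$ (a permutation with $\tau^2=\mathrm{id}$, possibly with fixed points) such that every $3$-element subset $S\subseteq[n]$ satisfies $$|E(G[S])|+|E(G[\tau(S)])|\ge 2 .$$ Then $|E(G)|\ge |E(T(n))|=\binom{\lfloor n/2\rfloor}{2}+\binom{\lceil n/2\rceil}{2}$.
   Context: $G[A]$ denotes the subgraph of $G$ induced on the vertex subset $A$, and $\tau(S)=\{\tau(s):s\in S\}$. $T(n)$ denotes the graph on $[n]$ that is the disjoint union of two cliques of sizes $\lfloor n/2\rfloor$ and $\lceil n/2\rceil$. -}

module Defs where

open import Data.Fin.Base using (Fin; toℕ)
open import Data.Fin.Properties using (_≟_; _<?_; any?)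
open import Data.Fin.Subset using (Subset; _∈_; _∩_; ⊤)
open import Data.Fin.Subset.Properties using (_∈?_; x∈p∩q⁺; ∈⊤)
open import Data.List.Base using (List; allFin; cartesianProduct; filter)
import Data.Nat.Base as ℕ
import Data.Nat.Properties as ℕ
open import Data.Nat.Base using (ℕ; ⌊_/2⌋)
open import Data.Product.Base using (_×_; _,_)
open import Data.Sum.Base using (_⊎_; map)
open import Data.Vec.Base using (tabulate)
open import Level using (0ℓ)
open import Relation.Binary.Core using (Rel)
open import Relation.Binary.Definitions using (Decidable; Symmetric)
open import Relation.Binary.PropositionalEquality.Core using (_≢_; refl; ≢-sym)
open import Relation.Nullary.Decidable.Core using (does; ¬?; _×-dec_; _⊎-dec_)
open import Relation.Nullary.Negation.Core using (¬_)

-- Finite simple graphs with vertex set V ⊆ {0,…,n-1}; a graph on the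
-- whole set [n] is a Graph {n} ⊤.
record Graph {n : ℕ} (V : Subset n) : Set₁ where
  field
    Adj     : Rel (Fin n) 0ℓ
    adj?    : Decidable Adj
    symm    : Symmetric Adj
    irrefl  : ∀ {x} → ¬ Adj x x
    -- With symm, this confines both ends of every edge to V.
    adj⇒∈   : ∀ {x y} → Adj x y → x ∈ V

open Graph public

-- The edge {x , y} is listed exactly once, as the pair (x , y) with x < y.
E : {n : ℕ} {V : Subset n} → Graph V → List (Fin n × Fin n)
E {n} G = filter (λ (x , y) → (x <? y) ×-dec adj? G x y)
                 (cartesianProduct (allFin n) (allFin n))

infix 8 _[_]

_[_] : {n : ℕ} {V : Subset n} → Graph V → (A : Subset n) → Graph (V ∩ A)
G [ A ] = record
  { Adj    = λ x y → Adj G x y × x ∈ A × y ∈ A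
  ; adj?   = λ x y → adj? G x y ×-dec ((x ∈? A) ×-dec (y ∈? A))
  ; symm   = λ (xy , x∈A , y∈A) → symm G xy , y∈A , x∈A
  ; irrefl = λ (xx , _) → irrefl G xx
  ; adj⇒∈  = λ (xy , x∈A , _) → x∈p∩q⁺ (adj⇒∈ G xy , x∈A)
  }

image : {n : ℕ} → (Fin n → Fin n) → Subset n → Subset n
image f S = tabulate λ y → does (any? λ x → (x ∈? S) ×-dec (f x ≟ y))

-- The two cliques are on the first ⌊n/2⌋ vertices and on the
-- remaining n - ⌊n/2⌋ = ⌈n/2⌉ vertices.
T : (n : ℕ) → Graph {n} ⊤
T n = record
  { Adj    = λ x y → x ≢ y × ((Low x × Low y) ⊎ (High x × High y))
  ; adj?   = λ x y → ¬? (x ≟ y) ×-dec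
               (((toℕ x ℕ.<? h) ×-dec (toℕ y ℕ.<? h)) ⊎-dec
                ((h ℕ.≤? toℕ x) ×-dec (h ℕ.≤? toℕ y)))
  ; symm   = λ (x≢y , s) →
               ≢-sym x≢y , map (λ (a , b) → b , a) (λ (a , b) → b , a) s
  ; irrefl = λ (x≢x , _) → x≢x refl
  ; adj⇒∈  = λ _ → ∈⊤
  }
  where
  h : ℕ
  h = ⌊ n /2⌋

  Low High : Fin n → Set
  Low  x = toℕ x ℕ.< h
  High x = h ℕ.≤ toℕ x

{-# OPTIONS --safe #-}

-- Let w(u,v) count how many of the pairs {u,v}, {τu,τv} are edges. Every
-- triple has w-weight at least 2, and the total weight of all pairs is 2|E(G)|.
-- There are u ≠ v with w(u,z) + w(v,z) ≥ 2 for all other z: a pair of weight 0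
-- if there is one, and any pair otherwise. Deleting u and v thus loses weight
-- at least 2(n-2), which is the growth of 2|E(T(n))| from n-2 to n.
module Submission where

open import Defs
open import Algebra.Definitions using (Involutive)
open import Data.Bool.Base using (Bool; true; false; not; if_then_else_)
open import Data.Fin.Base using (Fin; zero; suc; toℕ)
open import Data.Fin.Permutation using (_⟨$⟩ʳ_)
open import Data.Fin.Properties using (_≟_; _<?_; <-cmp; any?)
open import Data.Fin.Subset using (Subset; ⊤; ∣_∣; ⁅_⁆; _∪_; _∈_; _∉_)
open import Data.Fin.Subset.Properties
  using (_∈?_; x∈⁅y⁆⇒x≡y; x∈p∪q⁻; ∪-identityˡ; ∣⁅x⁆∣≡1)
open import Data.List.Base
  using (List; []; _∷_; _++_; map; length; filter; allFin; cartesianProduct)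
open import Data.List.Membership.Propositional as List using (find)
open import Data.List.Membership.Propositional.Properties
  using (∈-∃++; ∈-allFin; ∈-map⁺)
open import Data.List.Properties
  using (map-++; map-∘; map-tabulate; length-tabulate)
open import Data.List.Relation.Binary.Permutation.Propositional
  using (_↭_; prep; ↭-trans; ↭-refl; ↭-swap; ↭⇒↭ₛ)
open import Data.List.Relation.Binary.Permutation.Propositional.Properties
  using (shift; map⁺; ↭-length; ∈-resp-↭)
open import Data.List.Relation.Binary.Permutation.Setoid.Properties
  using (Unique-resp-↭)
open import Data.List.Relation.Unary.All as All using (All; []; _∷_)
open import Data.List.Relation.Unary.AllPairs using (AllPairs; []; _∷_)
open import Data.List.Relation.Unary.Any using (here; there)
open import Data.List.Relation.Unary.Unique.Propositional using (Unique)
open import Data.List.Relation.Unary.Unique.Propositional.Properties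
  using (allFin⁺)
open import Data.Nat.Base
  using (ℕ; zero; suc; _+_; _*_; _≤_; _≥_; z≤n; s≤s; ⌊_/2⌋; ⌈_/2⌉)
open import Data.Nat.Combinatorics using (_C_; nCk+nC[k+1]≡[n+1]C[k+1]; nC1≡n)
open import Data.Nat.ListAction using (sum)
open import Data.Nat.ListAction.Properties using (sum-++; sum-↭)
import Data.Nat.Properties as ℕ
open import Data.Nat.Tactic.RingSolver using (solve-∀)
open import Data.Product using (_×_; _,_; proj₁; ∃-syntax)
open import Data.Sum.Base using (_⊎_; inj₁; inj₂)
open import Data.Vec.Base using (_∷_; here; there)
open import Data.Vec.Properties using (lookup∘tabulate; []=⇒lookup)
open import Function.Base using (_∘_; _$_; id)
open import Relation.Binary.Definitions using (tri<; tri≈; tri>)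
open import Relation.Binary.PropositionalEquality
  using (_≡_; _≢_; refl; sym; trans; cong; cong₂; subst; setoid; module ≡-Reasoning)
open import Relation.Nullary.Decidable
  using (Dec; yes; no; does; _×-dec_)
open import Relation.Nullary.Negation using (¬_; contradiction)
open import Relation.Unary using (Decidable)

private variable
  A B P Q : Set
  n : ℕ

-- Finite sums

∑ : List A → (A → ℕ) → ℕ
∑ xs f = sum (map f xs)

∑∑ : List A → (A → A → ℕ) → ℕ
∑∑ xs w = ∑ xs λ x → ∑ xs (w x)

∑-cong : ∀ xs {f g : A → ℕ} → (∀ x → f x ≡ g x) → ∑ xs f ≡ ∑ xs g
∑-cong []       f≡g = refl
∑-cong (x ∷ xs) f≡g = cong₂ _+_ (f≡g x) (∑-cong xs f≡g)

∑-mono : ∀ xs {f g : A → ℕ} → (∀ x → f x ≤ g x) → ∑ xs f ≤ ∑ xs g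
∑-mono []       f≤g = z≤n
∑-mono (x ∷ xs) f≤g = ℕ.+-mono-≤ (f≤g x) (∑-mono xs f≤g)

∑∑-cong : ∀ xs {v w : A → A → ℕ} → (∀ x y → v x y ≡ w x y) → ∑∑ xs v ≡ ∑∑ xs w
∑∑-cong xs v≡w = ∑-cong xs λ x → ∑-cong xs (v≡w x)

∑-const : ∀ (xs : List A) k → ∑ xs (λ _ → k) ≡ length xs * k
∑-const []       k = refl
∑-const (x ∷ xs) k = cong (k +_) (∑-const xs k)

∑-zero : ∀ (xs : List A) {f} → (∀ x → f x ≡ 0) → ∑ xs f ≡ 0
∑-zero []       f≡0 = refl
∑-zero (x ∷ xs) f≡0 = cong₂ _+_ (f≡0 x) (∑-zero xs f≡0)

∑-+ : ∀ xs (f g : A → ℕ) → ∑ xs (λ x → f x + g x) ≡ ∑ xs f + ∑ xs g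
∑-+ []       f g = refl
∑-+ (x ∷ xs) f g = trans (cong (f x + g x +_) (∑-+ xs f g))
  (interchange (f x) (g x) (∑ xs f) (∑ xs g))
  where
  interchange : ∀ a b c d → a + b + (c + d) ≡ a + c + (b + d)
  interchange = solve-∀

∑∑-+ : ∀ xs (v w : A → A → ℕ) → ∑∑ xs (λ x y → v x y + w x y) ≡ ∑∑ xs v + ∑∑ xs w
∑∑-+ xs v w = trans (∑-cong xs λ x → ∑-+ xs (v x) (w x)) (∑-+ xs _ _)

∑-*ˡ : ∀ xs k (f : A → ℕ) → ∑ xs (λ x → k * f x) ≡ k * ∑ xs f
∑-*ˡ []       k f = sym (ℕ.*-zeroʳ k)
∑-*ˡ (x ∷ xs) k f =
  trans (cong (k * f x +_) (∑-*ˡ xs k f)) (sym (ℕ.*-distribˡ-+ k (f x) _))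

∑-*ʳ : ∀ xs k (f : A → ℕ) → ∑ xs (λ x → f x * k) ≡ ∑ xs f * k
∑-*ʳ xs k f = begin
  ∑ xs (λ x → f x * k)  ≡⟨ ∑-cong xs (λ x → ℕ.*-comm (f x) k) ⟩
  ∑ xs (λ x → k * f x)  ≡⟨ ∑-*ˡ xs k f ⟩
  k * ∑ xs f            ≡⟨ ℕ.*-comm k _ ⟩
  ∑ xs f * k            ∎
  where open ≡-Reasoning

∑∑-product : ∀ xs (f : A → ℕ) → ∑∑ xs (λ x y → f x * f y) ≡ ∑ xs f * ∑ xs f
∑∑-product xs f = trans (∑-cong xs λ x → ∑-*ˡ xs (f x) f) (∑-*ʳ xs (∑ xs f) f)

∑-swap : ∀ (xs : List A) (ys : List B) (w : A → B → ℕ) →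
         ∑ xs (λ x → ∑ ys (w x)) ≡ ∑ ys (λ y → ∑ xs (λ x → w x y))
∑-swap []       ys w = sym (∑-zero ys λ _ → refl)
∑-swap (x ∷ xs) ys w = trans (cong (∑ ys (w x) +_) (∑-swap xs ys w))
                             (sym (∑-+ ys (w x) _))

∑-++ : ∀ xs ys (f : A → ℕ) → ∑ (xs ++ ys) f ≡ ∑ xs f + ∑ ys f
∑-++ xs ys f = trans (cong sum (map-++ f xs ys)) (sum-++ (map f xs) (map f ys))

∑-map : ∀ xs (g : A → B) f → ∑ (map g xs) f ≡ ∑ xs (f ∘ g)
∑-map xs g f = cong sum (sym (map-∘ xs))

∑-↭ : ∀ {xs ys} (f : A → ℕ) → xs ↭ ys → ∑ xs f ≡ ∑ ys f
∑-↭ f p = sum-↭ (map⁺ f p)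

∑∑-↭ : ∀ {xs ys} (w : A → A → ℕ) → xs ↭ ys → ∑∑ xs w ≡ ∑∑ ys w
∑∑-↭ {xs = xs} w p = trans (∑-cong xs λ x → ∑-↭ (w x) p) (∑-↭ _ p)

∑-cartesianProduct : ∀ (xs : List A) (ys : List B) f →
  ∑ (cartesianProduct xs ys) f ≡ ∑ xs λ x → ∑ ys λ y → f (x , y)
∑-cartesianProduct []       ys f = refl
∑-cartesianProduct (x ∷ xs) ys f = trans (∑-++ (map (x ,_) ys) _ f)
  (cong₂ _+_ (∑-map ys (x ,_) f) (∑-cartesianProduct xs ys f))

∑-allFin-suc : ∀ (f : Fin (suc n) → ℕ) →
               ∑ (allFin (suc n)) f ≡ f zero + ∑ (allFin n) (f ∘ suc)
∑-allFin-suc {n} f = cong (λ ks → f zero + sum ks)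
  (trans (map-tabulate suc f) (sym (map-tabulate id (f ∘ suc))))

∈⇒↭ : ∀ {x : A} {xs} → x List.∈ xs → ∃[ ys ] xs ↭ x ∷ ys
∈⇒↭ x∈xs with ys , zs , refl ← ∈-∃++ x∈xs = ys ++ zs , shift _ ys zs

-- Each entry of `xs` either contributes 0 or is cancelled against a copy in `ys`, and distinctness
-- of `xs` prevents a copy from being used twice. This serves both to restrict sums over all
-- vertices to a triple and to reindex sums along an involution.
∑-⊆ : ∀ {xs ys} (f : A → ℕ) → Unique xs →
      (∀ {x} → x List.∈ xs → x List.∈ ys ⊎ f x ≡ 0) → ∑ xs f ≤ ∑ ys f
∑-⊆ f [] _ = z≤n
∑-⊆ {xs = x ∷ xs} {ys} f (x∉xs ∷ uniq) sup with sup (here refl)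
... | inj₂ fx≡0 =
  subst (_≤ ∑ ys f) (cong (_+ ∑ xs f) (sym fx≡0)) (∑-⊆ f uniq (sup ∘ there))
... | inj₁ x∈ys with zs , p ← ∈⇒↭ x∈ys =
  subst (f x + ∑ xs f ≤_) (sym (∑-↭ f p)) (ℕ.+-monoʳ-≤ (f x) (∑-⊆ f uniq sup′))
  where
  sup′ : ∀ {y} → y List.∈ xs → y List.∈ zs ⊎ f y ≡ 0
  sup′ y∈xs with sup (there y∈xs)
  ... | inj₂ fy≡0 = inj₂ fy≡0
  ... | inj₁ y∈ys with ∈-resp-↭ p y∈ys
  -- The copy of `x` is already used up, but `y` differs from `x` because `xs` has no repetitions.
  ...   | here refl   = contradiction refl (All.lookup x∉xs y∈xs)
  ...   | there y∈zs  = inj₁ y∈zs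

-- Indicators

bit : Bool → ℕ
bit b = if b then 1 else 0

-- Only the Boolean of a decision is read, so indicators of compound decisions compute from their
-- parts, and identities such as `cliques` reduce to case analysis on Booleans.
⟦_⟧ : Dec P → ℕ
⟦ P? ⟧ = bit (does P?)

⟦⟧-true : (P? : Dec P) → P → ⟦ P? ⟧ ≡ 1
⟦⟧-true (yes _) p = refl
⟦⟧-true (no ¬p) p = contradiction p ¬p

⟦⟧-false : (P? : Dec P) → ¬ P → ⟦ P? ⟧ ≡ 0
⟦⟧-false (yes p) ¬p = contradiction p ¬p
⟦⟧-false (no _)  ¬p = refl

⟦⟧-mono : (P? : Dec P) (Q? : Dec Q) → (P → Q) → ⟦ P? ⟧ ≤ ⟦ Q? ⟧
⟦⟧-mono (no _)  Q? f = z≤n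
⟦⟧-mono (yes p) Q? f = ℕ.≤-reflexive (sym (⟦⟧-true Q? (f p)))

⟦⟧-cong : (P? : Dec P) (Q? : Dec Q) → (P → Q) → (Q → P) → ⟦ P? ⟧ ≡ ⟦ Q? ⟧
⟦⟧-cong P? Q? f g = ℕ.≤-antisym (⟦⟧-mono P? Q? f) (⟦⟧-mono Q? P? g)

⟦⟧-× : (P? : Dec P) (Q? : Dec Q) → ⟦ P? ×-dec Q? ⟧ ≡ ⟦ P? ⟧ * ⟦ Q? ⟧
⟦⟧-× (no _)  Q? = refl
⟦⟧-× (yes _) Q? = sym (ℕ.*-identityˡ ⟦ Q? ⟧)

length-filter≡∑ : {P : A → Set} (P? : Decidable P) (xs : List A) →
                  length (filter P? xs) ≡ ∑ xs λ x → ⟦ P? x ⟧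
length-filter≡∑ P? [] = refl
length-filter≡∑ P? (x ∷ xs) with does (P? x)
... | true  = cong suc (length-filter≡∑ P? xs)
... | false = length-filter≡∑ P? xs

∑-⟦≟⟧ : (x : Fin n) → ∑ (allFin n) (λ y → ⟦ x ≟ y ⟧) ≡ 1
∑-⟦≟⟧ {suc n} zero    = trans (∑-allFin-suc {n} λ y → ⟦ zero ≟ y ⟧)
                              (cong suc (∑-zero (allFin n) λ _ → refl))
∑-⟦≟⟧ {suc n} (suc x) = trans (∑-allFin-suc {n} λ y → ⟦ suc x ≟ y ⟧) (∑-⟦≟⟧ x)

-- Weights in which every triple has weight at least 2

turán : ℕ → ℕ
turán n = (⌊ n /2⌋ C 2) + (⌈ n /2⌉ C 2)

suc-C-2 : ∀ k → suc k C 2 ≡ k + k C 2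
suc-C-2 k = trans (sym (nCk+nC[k+1]≡[n+1]C[k+1] k 1)) (cong (_+ k C 2) (nC1≡n k))

-- Each half gains one vertex, which forms a new pair with every old vertex of its half. Together
-- the halves have `n` old vertices.
turán-+2 : ∀ n → turán (2 + n) ≡ n + turán n
turán-+2 n = begin
  (suc h C 2) + (suc c C 2)        ≡⟨ cong₂ _+_ (suc-C-2 h) (suc-C-2 c) ⟩
  h + h C 2 + (c + c C 2)          ≡⟨ rearrange h (h C 2) c (c C 2) ⟩
  h + c + (h C 2 + c C 2)          ≡⟨ cong (_+ turán n) (ℕ.⌊n/2⌋+⌈n/2⌉≡n n) ⟩
  n + turán n                      ∎
  where
  open ≡-Reasoning
  h = ⌊ n /2⌋
  c = ⌈ n /2⌉
  rearrange : ∀ a b c d → a + b + (c + d) ≡ a + c + (b + d)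
  rearrange = solve-∀

module _ (w : A → A → ℕ) (w-sym : ∀ x y → w x y ≡ w y x)
         (triple : ∀ {a b c} → a ≢ b → a ≢ c → b ≢ c → 2 ≤ w a b + (w a c + w b c))
  where

  -- An exhaustive search decides the alternative. A pair that is found comes at the front of a
  -- permutation of `xs`, so that `zs` is what remains once the pair is deleted.
  zero-pair : ∀ xs → AllPairs (λ u v → 1 ≤ w u v) xs ⊎
                     (∃[ u ] ∃[ v ] ∃[ zs ] (xs ↭ u ∷ v ∷ zs × w u v ≡ 0))
  zero-pair [] = inj₁ []
  zero-pair (x ∷ xs) with All.decide pos? xs | zero-pair xs
    where
    pos? : ∀ y → 1 ≤ w x y ⊎ w x y ≡ 0
    pos? y with w x y
    ... | zero  = inj₂ refl
    ... | suc _ = inj₁ (s≤s z≤n)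
  ... | inj₁ pos | inj₁ allpos = inj₁ (pos ∷ allpos)
  -- Two transpositions carry `x` past the pair found further down the list.
  ... | inj₁ _   | inj₂ (u , v , zs , p , uv≡0) =
    inj₂ (u , v , x ∷ zs ,
          ↭-trans (prep x p) (↭-trans (↭-swap x u ↭-refl) (prep u (↭-swap x v ↭-refl))) ,
          uv≡0)
  ... | inj₂ any | _ with v , v∈xs , xv≡0 ← find any with zs , p ← ∈⇒↭ v∈xs =
    inj₂ (x , v , zs , prep x p , xv≡0)

  heavy-pair : ∀ {m} xs → length xs ≡ 2 + m → Unique xs →
    ∃[ u ] ∃[ v ] ∃[ zs ] (xs ↭ u ∷ v ∷ zs × All (λ z → 2 ≤ w u z + w v z) zs)
  heavy-pair xs len uniq with zero-pair xs
  heavy-pair (u ∷ v ∷ zs) len uniq | inj₁ ((_ ∷ pu) ∷ pv ∷ _) =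
    -- All pairs have positive weight, so the first two entries serve; `len` ensures that there are
    -- two.
    u , v , zs , ↭-refl , All.zipWith (λ (p , q) → ℕ.+-mono-≤ p q) (pu , pv)
  heavy-pair xs len uniq | inj₂ (u , v , zs , p , uv≡0)
    with (u≢v ∷ u∉zs) ∷ v∉zs ∷ _ ← Unique-resp-↭ (setoid _) (↭⇒↭ₛ p) uniq =
    u , v , zs , p ,
    -- Distinctness, carried along the permutation, makes `u`, `v`, `z` a triple. Its weight of at
    -- least 2 must come from the two pairs at `z`, since the pair `u`, `v` has weight 0.
    All.zipWith (λ {z} (u≢z , v≢z) →
      subst (λ k → 2 ≤ k + (w u z + w v z)) uv≡0 (triple u≢v u≢z v≢z)) (u∉zs , v∉zs)

  ∑-heavy : ∀ {u v} zs → All (λ z → 2 ≤ w u z + w v z) zs →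
            length zs * 2 ≤ ∑ zs (w u) + ∑ zs (w v)
  ∑-heavy {u} {v} zs heavy =
    subst (length zs * 2 ≤_) (∑-+ zs (w u) (w v)) (go heavy)
    where
    go : ∀ {zs} → All (λ z → 2 ≤ w u z + w v z) zs →
         length zs * 2 ≤ ∑ zs (λ z → w u z + w v z)
    go []       = z≤n
    go (h ∷ hs) = ℕ.+-mono-≤ h (go hs)

  -- The square array of weights splits into the 2 by 2 block of `u` and `v`, their rows and columns
  -- over `zs`, and the array over `zs`. Symmetry identifies rows with columns, hence the factor 2.
  ∑∑-∷∷ : ∀ u v zs → ∑∑ (u ∷ v ∷ zs) w ≡
    w u u + w u v + w v u + w v v +
    (2 * (∑ zs (w u) + ∑ zs (w v)) + ∑∑ zs w)
  ∑∑-∷∷ u v zs = begin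
    w u u + (w u v + ∑ zs (w u)) + (w v u + (w v v + ∑ zs (w v)) +
      ∑ zs (λ x → w x u + (w x v + ∑ zs (w x))))
      ≡⟨ cong (λ k → w u u + (w u v + ∑ zs (w u)) + (w v u + (w v v + ∑ zs (w v)) + k))
           columns ⟩
    w u u + (w u v + ∑ zs (w u)) + (w v u + (w v v + ∑ zs (w v)) +
      (∑ zs (w u) + (∑ zs (w v) + ∑∑ zs w)))
      ≡⟨ rearrange (w u u) (w u v) (∑ zs (w u)) (w v u) (w v v) (∑ zs (w v)) _ ⟩
    _ ∎
    where
    open ≡-Reasoning
    columns : ∑ zs (λ x → w x u + (w x v + ∑ zs (w x))) ≡
              ∑ zs (w u) + (∑ zs (w v) + ∑∑ zs w)
    columns = trans (∑-+ zs _ _) (cong₂ _+_ (∑-cong zs λ x → w-sym x u)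
      (trans (∑-+ zs _ _) (cong (_+ ∑∑ zs w) (∑-cong zs λ x → w-sym x v))))
    rearrange : ∀ a b s c d t r → a + (b + s) + (c + (d + t) + (s + (t + r))) ≡
                a + b + c + d + (2 * (s + t) + r)
    rearrange = solve-∀

  -- Induction in steps of two. The factor 4 is a product of two factors 2: the double sum meets
  -- each pair in both orders, and the total weight of the pairs is compared with `2 * turán m`.
  turán≤∑∑ : ∀ m xs → length xs ≡ m → Unique xs → 4 * turán m ≤ ∑∑ xs w
  -- With at most one vertex both binomial coefficients vanish.
  turán≤∑∑ 0 xs _ _ = z≤n
  turán≤∑∑ 1 xs _ _ = z≤n
  turán≤∑∑ (suc (suc m)) xs len uniq
    with u , v , zs , p , heavy ← heavy-pair xs len uniq = begin
    4 * turán (2 + m)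
      ≡⟨ cong (4 *_) (turán-+2 m) ⟩
    4 * (m + turán m)
      ≡⟨ rearrange m (turán m) ⟩
    2 * (m * 2) + 4 * turán m
      ≡⟨ cong (λ k → 2 * (k * 2) + 4 * turán m) len-zs ⟨
    2 * (length zs * 2) + 4 * turán m
      ≤⟨ ℕ.+-mono-≤ (ℕ.*-monoʳ-≤ 2 (∑-heavy zs heavy)) (turán≤∑∑ m zs len-zs uniq-zs) ⟩
    2 * (∑ zs (w u) + ∑ zs (w v)) + ∑∑ zs w
      -- The weight inside the deleted pair, including its diagonal entries, is discarded.
      ≤⟨ ℕ.m≤n+m _ (w u u + w u v + w v u + w v v) ⟩
    w u u + w u v + w v u + w v v + (2 * (∑ zs (w u) + ∑ zs (w v)) + ∑∑ zs w)
      ≡⟨ ∑∑-∷∷ u v zs ⟨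
    ∑∑ (u ∷ v ∷ zs) w
      ≡⟨ ∑∑-↭ w p ⟨
    ∑∑ xs w ∎
    where
    open ℕ.≤-Reasoning
    len-zs : length zs ≡ m
    len-zs = ℕ.suc-injective (ℕ.suc-injective (trans (sym (↭-length p)) len))
    uniq-zs : Unique zs
    uniq-zs with _ ∷ _ ∷ uniq′ ← Unique-resp-↭ (setoid _) (↭⇒↭ₛ p) uniq = uniq′
    rearrange : ∀ m t → 4 * (m + t) ≡ 2 * (m * 2) + 4 * t
    rearrange = solve-∀

-- Edge counts

adj : ∀ {V : Subset n} → Graph V → Fin n → Fin n → ℕ
adj G x y = ⟦ adj? G x y ⟧

adj-sym : ∀ {V : Subset n} (G : Graph V) x y → adj G x y ≡ adj G y x
adj-sym G x y = ⟦⟧-cong (adj? G x y) (adj? G y x) (symm G) (symm G)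

adj-irrefl : ∀ {V : Subset n} (G : Graph V) x → adj G x x ≡ 0
adj-irrefl G x = ⟦⟧-false (adj? G x x) (irrefl G)

-- Each edge is listed with its smaller end first. Adding the transposed count gives both orders of
-- every pair of distinct vertices, and the diagonal contributes 0 because there are no loops.
2|E|≡∑∑adj : ∀ {V : Subset n} (G : Graph V) →
             length (E G) + length (E G) ≡ ∑∑ (allFin n) (adj G)
2|E|≡∑∑adj {n} G = begin
  length (E G) + length (E G)
    ≡⟨ cong₂ _+_ |E|≡ (trans |E|≡ (∑-swap (allFin n) (allFin n) ordered)) ⟩
  ∑∑ (allFin n) ordered + ∑∑ (allFin n) (λ x y → ordered y x)
    ≡⟨ ∑∑-+ (allFin n) ordered _ ⟨
  ∑∑ (allFin n) (λ x y → ordered x y + ordered y x)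
    ≡⟨ ∑∑-cong (allFin n) symmetrised ⟩
  ∑∑ (allFin n) (adj G) ∎
  where
  open ≡-Reasoning
  ordered : Fin n → Fin n → ℕ
  ordered x y = ⟦ (x <? y) ×-dec adj? G x y ⟧

  |E|≡ : length (E G) ≡ ∑∑ (allFin n) ordered
  |E|≡ = trans (length-filter≡∑ _ (cartesianProduct (allFin n) (allFin n)))
               (∑-cartesianProduct (allFin n) (allFin n) _)

  symmetrised : ∀ x y → ordered x y + ordered y x ≡ adj G x y
  symmetrised x y
    rewrite ⟦⟧-× (x <? y) (adj? G x y) | ⟦⟧-× (y <? x) (adj? G y x)
    with <-cmp x y
  ... | tri< x<y _ y≮x rewrite ⟦⟧-true (x <? y) x<y | ⟦⟧-false (y <? x) y≮x =
    trans (ℕ.+-identityʳ _) (ℕ.*-identityˡ _)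
  ... | tri> x≮y _ y<x rewrite ⟦⟧-false (x <? y) x≮y | ⟦⟧-true (y <? x) y<x =
    trans (ℕ.*-identityˡ _) (adj-sym G y x)
  ... | tri≈ x≮x refl _ rewrite ⟦⟧-false (x <? x) x≮x = sym (adj-irrefl G x)

-- After doubling, the array of adjacencies of `G [ S ]` has nonzero entries only in rows and
-- columns from `a`, `b`, `c`. Assuming just an inclusion for `S` lets the bound cover a triad and
-- its image alike.
|E[S]|≤ : (G : Graph {n} ⊤) (S : Subset n) {a b c : Fin n} →
          (∀ {x} → x ∈ S → x List.∈ a ∷ b ∷ c ∷ []) →
          length (E (G [ S ])) ≤ adj G a b + (adj G a c + adj G b c)
|E[S]|≤ {n} G S {a} {b} {c} S⊆abc = ℕ.*-cancelˡ-≤ 2 $ begin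
  2 * length (E (G [ S ]))
    ≡⟨ cong (length (E (G [ S ])) +_) (ℕ.+-identityʳ _) ⟩
  length (E (G [ S ])) + length (E (G [ S ]))
    ≡⟨ 2|E|≡∑∑adj (G [ S ]) ⟩
  ∑∑ (allFin n) (adj (G [ S ]))
    ≤⟨ ∑-⊆ _ (allFin⁺ n) (λ {x} _ → row-support x) ⟩
  ∑ abc (λ x → ∑ (allFin n) (adj (G [ S ]) x))
    ≤⟨ ∑-mono abc (λ x → ∑-⊆ _ (allFin⁺ n) (λ {y} _ → support x y)) ⟩
  ∑∑ abc (adj (G [ S ]))
    ≤⟨ ∑-mono abc (λ x → ∑-mono abc λ y →
         ⟦⟧-mono (adj? (G [ S ]) x y) (adj? G x y) proj₁) ⟩
  ∑∑ abc (adj G)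
    ≡⟨ ∑∑-abc ⟩
  2 * (adj G a b + (adj G a c + adj G b c)) ∎
  where
  open ℕ.≤-Reasoning
  abc : List (Fin n)
  abc = a ∷ b ∷ c ∷ []

  row-support : ∀ x → x List.∈ abc ⊎ ∑ (allFin n) (adj (G [ S ]) x) ≡ 0
  row-support x with x ∈? S
  ... | yes x∈S = inj₁ (S⊆abc x∈S)
  ... | no  x∉S = inj₂ (∑-zero (allFin n) λ y →
    ⟦⟧-false (adj? G x y ×-dec (no x∉S ×-dec (y ∈? S))) λ (_ , x∈S , _) → x∉S x∈S)

  support : ∀ x y → y List.∈ abc ⊎ adj (G [ S ]) x y ≡ 0
  support x y with y ∈? S
  ... | yes y∈S = inj₁ (S⊆abc y∈S)
  ... | no  y∉S =
    inj₂ (⟦⟧-false (adj? G x y ×-dec ((x ∈? S) ×-dec no y∉S)) λ (_ , _ , y∈S) → y∉S y∈S)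

  ∑∑-abc : ∑∑ abc (adj G) ≡ 2 * (adj G a b + (adj G a c + adj G b c))
  ∑∑-abc
    rewrite adj-irrefl G a | adj-irrefl G b | adj-irrefl G c
          | adj-sym G b a | adj-sym G c a | adj-sym G c b
    = double (adj G a b) (adj G a c) (adj G b c)
    where
    double : ∀ p q r → p + (q + 0) + (p + (r + 0) + (q + (r + 0) + 0)) ≡ 2 * (p + (q + r))
    double = solve-∀

-- Triples and their images

∣⁅x⁆∪p∣≡1+∣p∣ : ∀ {x : Fin n} {p} → x ∉ p → ∣ ⁅ x ⁆ ∪ p ∣ ≡ suc ∣ p ∣
∣⁅x⁆∪p∣≡1+∣p∣ {x = zero}  {true  ∷ p} x∉p = contradiction here x∉p
∣⁅x⁆∪p∣≡1+∣p∣ {x = zero}  {false ∷ p} x∉p = cong (suc ∘ ∣_∣) (∪-identityˡ p)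
∣⁅x⁆∪p∣≡1+∣p∣ {x = suc x} {true  ∷ p} x∉p = cong suc (∣⁅x⁆∪p∣≡1+∣p∣ (x∉p ∘ there))
∣⁅x⁆∪p∣≡1+∣p∣ {x = suc x} {false ∷ p} x∉p = ∣⁅x⁆∪p∣≡1+∣p∣ (x∉p ∘ there)

triad : (a b c : Fin n) → Subset n
triad a b c = ⁅ a ⁆ ∪ (⁅ b ⁆ ∪ ⁅ c ⁆)

∈-triad⁻ : ∀ {a b c x : Fin n} → x ∈ triad a b c → x List.∈ a ∷ b ∷ c ∷ []
∈-triad⁻ {a = a} {b} {c} x∈ with x∈p∪q⁻ ⁅ a ⁆ _ x∈
... | inj₁ x∈a = here (x∈⁅y⁆⇒x≡y a x∈a)
... | inj₂ x∈bc with x∈p∪q⁻ ⁅ b ⁆ ⁅ c ⁆ x∈bc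
...   | inj₁ x∈b = there (here (x∈⁅y⁆⇒x≡y b x∈b))
...   | inj₂ x∈c = there (there (here (x∈⁅y⁆⇒x≡y c x∈c)))

∣triad∣≡3 : ∀ {a b c : Fin n} → a ≢ b → a ≢ c → b ≢ c → ∣ triad a b c ∣ ≡ 3
∣triad∣≡3 {a = a} {b} {c} a≢b a≢c b≢c =
  trans (∣⁅x⁆∪p∣≡1+∣p∣ a∉bc)
        (cong suc (trans (∣⁅x⁆∪p∣≡1+∣p∣ (b≢c ∘ x∈⁅y⁆⇒x≡y c)) (cong suc (∣⁅x⁆∣≡1 c))))
  where
  a∉bc : a ∉ ⁅ b ⁆ ∪ ⁅ c ⁆
  a∉bc a∈bc with x∈p∪q⁻ ⁅ b ⁆ ⁅ c ⁆ a∈bc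
  ... | inj₁ a∈b = a≢b (x∈⁅y⁆⇒x≡y b a∈b)
  ... | inj₂ a∈c = a≢c (x∈⁅y⁆⇒x≡y c a∈c)

-- `image` stores the outcome of a search for a preimage. Membership says that the outcome is
-- `true`, so the search itself supplies the preimage.
∈-image⁻ : ∀ (f : Fin n → Fin n) S {y} → y ∈ image f S → ∃[ x ] (x ∈ S × f x ≡ y)
∈-image⁻ f S {y} y∈ = witness (any? λ x → (x ∈? S) ×-dec (f x ≟ y))
  (trans (sym (lookup∘tabulate _ y)) ([]=⇒lookup y∈))
  where
  witness : (P? : Dec P) → does P? ≡ true → P
  witness (yes p) _ = p

-- The edges of T n

does-complement : (P? : Dec P) (Q? : Dec Q) → (P → ¬ Q) → (¬ Q → P) →
                  does P? ≡ not (does Q?)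
does-complement (yes p) (yes q) f g = contradiction q (f p)
does-complement (yes _) (no _)  f g = refl
does-complement (no _)  (yes _) f g = refl
does-complement (no ¬p) (no ¬q) f g = contradiction (g ¬q) ¬p

-- This makes the upper clique the Boolean complement of the lower one, so a single Boolean per
-- vertex describes `T n`.
does-≤? : ∀ h k → does (h ℕ.≤? k) ≡ not (does (k ℕ.<? h))
does-≤? h k = does-complement (h ℕ.≤? k) (k ℕ.<? h) ℕ.≤⇒≯ ℕ.≮⇒≥

∑-⟦<?⟧ : ∀ {h} n → h ≤ n → ∑ (allFin n) (λ x → ⟦ toℕ x ℕ.<? h ⟧) ≡ h
∑-⟦<?⟧ {zero}  n       _         = ∑-zero (allFin n) λ _ → refl
∑-⟦<?⟧ {suc h} (suc n) (s≤s h≤n) =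
  trans (∑-allFin-suc {n} λ x → ⟦ toℕ x ℕ.<? suc h ⟧) (cong suc (∑-⟦<?⟧ n h≤n))

-- The ordered pairs from `k` elements are two for each unordered pair and `k` on the diagonal.
2*C2 : ∀ k → (k C 2 + k C 2) + k ≡ k * k
2*C2 zero = refl
2*C2 (suc k) = begin
  (suc k C 2 + suc k C 2) + suc k         ≡⟨ cong (λ t → (t + t) + suc k) (suc-C-2 k) ⟩
  (k + k C 2 + (k + k C 2)) + suc k       ≡⟨ rearrange k (k C 2) ⟩
  (k C 2 + k C 2 + k) + (k + suc k)       ≡⟨ cong (_+ (k + suc k)) (2*C2 k) ⟩
  k * k + (k + suc k)                     ≡⟨ square k ⟩
  suc k * suc k                           ∎
  where
  open ≡-Reasoning
  rearrange : ∀ k t → (k + t + (k + t)) + suc k ≡ (t + t + k) + (k + suc k)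
  rearrange = solve-∀
  square : ∀ k → k * k + (k + suc k) ≡ suc k * suc k
  square = solve-∀

double-injective : ∀ {m k} → m + m ≡ k + k → m ≡ k
double-injective {m} {k} eq = ℕ.*-cancelˡ-≡ m k 2
  (trans (cong (m +_) (ℕ.+-identityʳ m)) (trans eq (cong (k +_) (sym (ℕ.+-identityʳ k)))))

-- Filling in the diagonal turns the adjacency array of `T n` into two full square blocks, one for
-- each clique, and each block is a product of indicators. The blocks sum to `h * h` and `c * c`;
-- the `n` added diagonal entries cancel against those in `2*C2`.
|E[T]|≡turán : ∀ n → length (E (T n)) ≡ turán n
|E[T]|≡turán n = double-injective $ ℕ.+-cancelʳ-≡ n _ _ $ begin
  length (E (T n)) + length (E (T n)) + n
    ≡⟨ cong₂ _+_ (2|E|≡∑∑adj (T n)) (sym diagonal) ⟩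
  ∑∑ (allFin n) (adj (T n)) + ∑∑ (allFin n) (λ x y → ⟦ x ≟ y ⟧)
    ≡⟨ ∑∑-+ (allFin n) _ _ ⟨
  ∑∑ (allFin n) (λ x y → adj (T n) x y + ⟦ x ≟ y ⟧)
    ≡⟨ ∑∑-cong (allFin n) cliques ⟩
  ∑∑ (allFin n) (λ x y → low x * low y + high x * high y)
    ≡⟨ ∑∑-+ (allFin n) _ _ ⟩
  ∑∑ (allFin n) (λ x y → low x * low y) + ∑∑ (allFin n) (λ x y → high x * high y)
    ≡⟨ cong₂ _+_ (∑∑-product (allFin n) low) (∑∑-product (allFin n) high) ⟩
  ∑ (allFin n) low * ∑ (allFin n) low + ∑ (allFin n) high * ∑ (allFin n) high
    ≡⟨ cong₂ (λ a b → a * a + b * b) ∑-low ∑-high ⟩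
  h * h + c * c
    ≡⟨ cong₂ _+_ (2*C2 h) (2*C2 c) ⟨
  h C 2 + h C 2 + h + (c C 2 + c C 2 + c)
    ≡⟨ rearrange (h C 2) h (c C 2) c ⟩
  turán n + turán n + (h + c)
    ≡⟨ cong (turán n + turán n +_) (ℕ.⌊n/2⌋+⌈n/2⌉≡n n) ⟩
  turán n + turán n + n ∎
  where
  open ≡-Reasoning
  h = ⌊ n /2⌋
  c = ⌈ n /2⌉

  low high : Fin n → ℕ
  low  x = ⟦ toℕ x ℕ.<? h ⟧
  high x = ⟦ h ℕ.≤? toℕ x ⟧

  rearrange : ∀ s h t c → s + s + h + (t + t + c) ≡ s + t + (s + t) + (h + c)
  rearrange = solve-∀

  |allFin| : length (allFin n) ≡ n
  |allFin| = length-tabulate {n = n} id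

  diagonal : ∑∑ (allFin n) (λ x y → ⟦ x ≟ y ⟧) ≡ n
  diagonal = trans (∑-cong (allFin n) ∑-⟦≟⟧)
    (trans (∑-const (allFin n) 1) (trans (ℕ.*-identityʳ _) |allFin|))

  ∑-low : ∑ (allFin n) low ≡ h
  ∑-low = ∑-⟦<?⟧ n (ℕ.⌊n/2⌋≤n n)

  low+high : ∀ x → low x + high x ≡ 1
  low+high x rewrite does-≤? h (toℕ x) with does (toℕ x ℕ.<? h)
  ... | true  = refl
  ... | false = refl

  ∑-high : ∑ (allFin n) high ≡ c
  -- Every vertex lies in exactly one clique, so the upper one receives the `c` vertices left over
  -- by the lower one.
  ∑-high = ℕ.+-cancelˡ-≡ h _ _ $ begin
    h + ∑ (allFin n) high                    ≡⟨ cong (_+ ∑ (allFin n) high) ∑-low ⟨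
    ∑ (allFin n) low + ∑ (allFin n) high     ≡⟨ ∑-+ (allFin n) low high ⟨
    ∑ (allFin n) (λ x → low x + high x)      ≡⟨ ∑-cong (allFin n) low+high ⟩
    ∑ (allFin n) (λ _ → 1)                   ≡⟨ ∑-const (allFin n) 1 ⟩
    length (allFin n) * 1                    ≡⟨ ℕ.*-identityʳ _ ⟩
    length (allFin n)                        ≡⟨ |allFin| ⟩
    n                                        ≡⟨ ℕ.⌊n/2⌋+⌈n/2⌉≡n n ⟨
    h + c                                    ∎

  cliques : ∀ x y → adj (T n) x y + ⟦ x ≟ y ⟧ ≡ low x * low y + high x * high y
  cliques x y rewrite does-≤? h (toℕ x) | does-≤? h (toℕ y) with x ≟ y
  ... | yes refl with does (toℕ x ℕ.<? h)
  ...   | true  = refl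
  ...   | false = refl
  cliques x y | no _ with does (toℕ x ℕ.<? h) | does (toℕ y ℕ.<? h)
  ...   | true  | true  = refl
  ...   | true  | false = refl
  ...   | false | true  = refl
  ...   | false | false = refl

-- The involution and the lower bound for `G`

∑-involutive-≤ : (f : Fin n → Fin n) → Involutive _≡_ f → (g : Fin n → ℕ) →
                 ∑ (allFin n) g ≤ ∑ (allFin n) (g ∘ f)
-- Each `x` is the value of `f` at `f x`, so every vertex occurs among the values of `f`.
∑-involutive-≤ {n} f inv g = subst (∑ (allFin n) g ≤_) (∑-map (allFin n) f g)
  (∑-⊆ g (allFin⁺ n) λ {x} _ →
    inj₁ (subst (List._∈ map f (allFin n)) (inv x) (∈-map⁺ f (∈-allFin (f x)))))

module _ (G : Graph {n} ⊤) (f : Fin n → Fin n) (inv : Involutive _≡_ f)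
         (dense : (S : Subset n) → ∣ S ∣ ≡ 3 →
                  length (E (G [ S ])) + length (E (G [ image f S ])) ≥ 2)
  where

  weight : Fin n → Fin n → ℕ
  weight x y = adj G x y + adj G (f x) (f y)

  weight-sym : ∀ x y → weight x y ≡ weight y x
  weight-sym x y = cong₂ _+_ (adj-sym G x y) (adj-sym G (f x) (f y))

  -- The six adjacencies among `a`, `b`, `c` and among their images bound the two edge counts in
  -- `dense`; grouping each adjacency with its image gives the three weights.
  weight-triple : ∀ {a b c} → a ≢ b → a ≢ c → b ≢ c →
                  2 ≤ weight a b + (weight a c + weight b c)
  weight-triple {a} {b} {c} a≢b a≢c b≢c = begin
    2
      ≤⟨ dense S (∣triad∣≡3 a≢b a≢c b≢c) ⟩
    length (E (G [ S ])) + length (E (G [ image f S ]))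
      ≤⟨ ℕ.+-mono-≤ (|E[S]|≤ G S ∈-triad⁻) (|E[S]|≤ G (image f S) image⊆) ⟩
    adj G a b + (adj G a c + adj G b c) +
      (adj G (f a) (f b) + (adj G (f a) (f c) + adj G (f b) (f c)))
      ≡⟨ rearrange (adj G a b) (adj G a c) (adj G b c) _ _ _ ⟩
    weight a b + (weight a c + weight b c) ∎
    where
    open ℕ.≤-Reasoning
    S : Subset n
    S = triad a b c
    image⊆ : ∀ {y} → y ∈ image f S → y List.∈ f a ∷ f b ∷ f c ∷ []
    image⊆ y∈ with x , x∈S , refl ← ∈-image⁻ f S y∈ = ∈-map⁺ f (∈-triad⁻ x∈S)
    rearrange : ∀ p q r s t u → p + (q + r) + (s + (t + u)) ≡ p + s + (q + t + (r + u))
    rearrange = solve-∀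

  -- Each of the two summands of `weight` contributes at most twice the number of edges, the second
  -- one after reindexing by `f`.
  ∑∑-weight : ∑∑ (allFin n) weight ≤ 4 * length (E G)
  ∑∑-weight = begin
    ∑∑ (allFin n) weight
      ≡⟨ ∑∑-+ (allFin n) (adj G) _ ⟩
    ∑∑ (allFin n) (adj G) + ∑∑ (allFin n) (λ x y → adj G (f x) (f y))
      ≤⟨ ℕ.+-monoʳ-≤ (∑∑ (allFin n) (adj G)) reindex ⟩
    ∑∑ (allFin n) (adj G) + ∑∑ (allFin n) (adj G)
      ≡⟨ cong (λ k → k + k) (2|E|≡∑∑adj G) ⟨
    e + e + (e + e)
      ≡⟨ quadruple e ⟩
    4 * e ∎
    where
    open ℕ.≤-Reasoning
    e = length (E G)
    quadruple : ∀ e → e + e + (e + e) ≡ 4 * e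
    quadruple = solve-∀
    reindex : ∑∑ (allFin n) (λ x y → adj G (f x) (f y)) ≤ ∑∑ (allFin n) (adj G)
    reindex = begin
      ∑∑ (allFin n) (λ x y → adj G (f x) (f y))
        -- The columns are reindexed first and the rows next; then `f` cancels against itself in
        -- both arguments.
        ≤⟨ ∑-mono (allFin n) (λ x → ∑-involutive-≤ f inv _) ⟩
      ∑∑ (allFin n) (λ x y → adj G (f x) (f (f y)))
        ≤⟨ ∑-involutive-≤ f inv _ ⟩
      ∑∑ (allFin n) (λ x y → adj G (f (f x)) (f (f y)))
        ≡⟨ ∑∑-cong (allFin n) (λ x y → cong₂ (adj G) (inv x) (inv y)) ⟩
      ∑∑ (allFin n) (adj G) ∎

  turán≤|E| : turán n ≤ length (E G)
  turán≤|E| = ℕ.*-cancelˡ-≤ 4 (ℕ.≤-trans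
    (turán≤∑∑ weight weight-sym weight-triple n (allFin n) (length-tabulate id) (allFin⁺ n))
    ∑∑-weight)

mainTheorem1 : (n : ℕ) → n ≥ 1 →
    (G : Graph {n} ⊤) →
    (∃[ τ ] (Involutive _≡_ (_⟨$⟩ʳ_ {n} {n} τ) ×
    ((S : Subset n) → ∣ S ∣ ≡ 3 →
    length (E (G [ S ])) + length (E (G [ image (τ ⟨$⟩ʳ_) S ])) ≥ 2))) →
    (length (E G) ≥ length (E (T n))) ×
    (length (E (T n)) ≡ (⌊ n /2⌋ C 2) + (⌈ n /2⌉ C 2))
mainTheorem1 n _ G (τ , inv , dense) =
  subst (_≤ length (E G)) (sym (|E[T]|≡turán n)) (turán≤|E| G (τ ⟨$⟩ʳ_) inv dense) ,
  |E[T]|≡turán n
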